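{- As formal power series in $q$ (equivalently, as analytic functions for $|q|<1$), \[ \sum_{m,n\geq 0}\frac{q^{3\frac{m^2+m}{2}+2nm+n^2+3n+2m+1}}{(q;q)_m(q^4;q^4)_{\lfloor n/2\rfloor}}=\frac{1}{(q,q^5,q^6;q^8)_\infty}-\frac{1}{(q^2,q^3,q^7;q^8)_\infty}. \]
   Context: $(a;q)_k=\prod_{i=0}^{k-1}(1-aq^i)$, $(a;q)_\infty=\prod_{i\ge0}(1-aq^i)$, and $(a_1,\dots,a_r;q)_\infty=\prod_{j}(a_j;q)_\infty$. $\lfloor\cdot\rfloor$ is the floor function. -}

module Defs where

open import Data.Nat as ℕ using (ℕ; zero; suc; _∸_)
open import Data.Nat.DivMod using (_/_)
open import Data.Nat.Divisibility using (_∣?_)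
open import Data.Integer as ℤ using (ℤ; +_)
open import Relation.Nullary.Decidable using (does)
open import Data.Bool using (if_then_else_)

-- Formal power series in q with integer coefficients: n ↦ coefficient of q^n.
Series : Set
Series = ℕ → ℤ

Σ< : ℕ → (ℕ → ℤ) → ℤ
Σ< zero    f = + 0
Σ< (suc k) f = Σ< k f ℤ.+ f k

_⊕_ : Series → Series → Series
(f ⊕ g) n = f n ℤ.+ g n

_⊖_ : Series → Series → Series
(f ⊖ g) n = f n ℤ.- g n

_⊛_ : Series → Series → Series
(f ⊛ g) n = Σ< (suc n) (λ k → f k ℤ.* g (n ∸ k))

infixl 7 _⊛_
infixl 6 _⊕_ _⊖_

one : Series
one zero    = + 1
one (suc n) = + 0

mono : ℕ → Series
mono e n = if does (e ℕ.≟ n) then + 1 else + 0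

-- 1/(1 - q^k) = Σ_j q^{kj}  (used only for k ≥ 1)
geom : ℕ → Series
geom k n = if does (k ∣? n) then + 1 else + 0

invPoch : ℕ → ℕ → ℕ → Series
invPoch a d zero    = one
invPoch a d (suc m) = invPoch a d m ⊛ geom (a ℕ.+ d ℕ.* m)

expo : ℕ → ℕ → ℕ
expo m n = 3 ℕ.* ((m ℕ.* m ℕ.+ m) / 2) ℕ.+ 2 ℕ.* n ℕ.* m ℕ.+ n ℕ.* n
           ℕ.+ 3 ℕ.* n ℕ.+ 2 ℕ.* m ℕ.+ 1

term : ℕ → ℕ → Series
term m n = mono (expo m n) ⊛ invPoch 1 1 m ⊛ invPoch 4 4 (n / 2)

lhsPartial : ℕ → Series
lhsPartial K N = Σ< K (λ m → Σ< K (λ n → term m n N))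

rhsPartial : ℕ → Series
rhsPartial K = (invPoch 1 8 K ⊛ invPoch 5 8 K ⊛ invPoch 6 8 K)
             ⊖ (invPoch 2 8 K ⊛ invPoch 3 8 K ⊛ invPoch 7 8 K)

{-# OPTIONS --safe #-}

-- Work in ℤ[[q]] modulo q^(N+1), so that every sum and product is finite. With r = m + n the exponent is
-- r² + 3r + 1 + m(m+1)/2, and the coefficient of z^r in
--   (Σ q^(m(m+1)/2) z^m/(q;q)_m) (Σ z^n/(q⁴;q⁴)_⌊n/2⌋) = (-zq;q)_∞ (1+z)/(z²;q⁴)_∞ = (-zq;q²)_∞/(z;q²)_∞
-- replaces the inner sum. Expanding the last quotient by Euler's two identities instead turns the left side
-- into a sum over k, j; summing over j by Euler gives (-q²;q²)_∞ times a difference of two Euler sums in base q⁴: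
--   LHS = (-q²;q²)_∞ ((-q;q⁴)_∞ - (-q³;q⁴)_∞).
-- Clearing the products (-a;Q)_∞ (a;Q)_∞ = (a²;Q²)_∞ yields the right side.
module Submission where

open import Algebra.Bundles using (CommutativeRing)
import Algebra.Properties.AbelianGroup as AbelianGroupProperties
import Algebra.Solver.Ring.NaturalCoefficients.Default as RingSolver
open import Data.Bool using (if_then_else_)
open import Data.Integer as ℤ using (ℤ; +_)
import Data.Integer.Properties as ℤₚ
open import Data.Nat as ℕ using (ℕ; zero; suc; _≤_; _<_; z≤n; s≤s; ⌊_/2⌋)
import Data.Nat.Properties as ℕₚ
open import Data.Nat.DivMod using (_/_; m*n/n≡m; m/n≡1+[m∸n]/n)
open import Data.Nat.Divisibility using (_∣?_; >⇒∤; ∣m+n∣m⇒∣n; ∣m∣n⇒∣m+n; ∣-refl)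
open import Data.Nat.Solver using (module +-*-Solver)
open import Data.Product using (∃-syntax; _,_)
open import Function using (_∘_; mk⇔)
open import Level using (Level; _⊔_)
open import Relation.Binary.PropositionalEquality as ≡ using (_≡_)
import Relation.Binary.Reasoning.Setoid as SetoidReasoning
open import Relation.Nullary.Decidable using (yes; no; dec-false; does-⇔)

open import Defs

-- Power series over a commutative ring and their truncations.

module PowerSeries {c ℓ : Level} (R : CommutativeRing c ℓ) where
  open CommutativeRing R
  open SetoidReasoning setoid
  open RingSolver commutativeSemiring using (solve; _:+_; _:*_; _:=_)

  infixl 7 _∗_

  -- Peeling off `f 0` lets the ring laws go by induction on the degree with `f` shifted, free of
  -- truncated subtraction.
  _∗_ : (ℕ → Carrier) → (ℕ → Carrier) → ℕ → Carrier
  (f ∗ g) zero    = f 0 * g 0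
  (f ∗ g) (suc n) = f 0 * g (suc n) + ((f ∘ suc) ∗ g) n

  δ : ℕ → Carrier
  δ zero    = 1#
  δ (suc n) = 0#

  -- The hypotheses stop at `n`, so that agreement up to a fixed degree is a congruence in
  -- `truncatedRing`.
  ∗-cong : ∀ n {f f′ g g′} → (∀ k → k ≤ n → f k ≈ f′ k) → (∀ k → k ≤ n → g k ≈ g′ k) →
           (f ∗ g) n ≈ (f′ ∗ g′) n
  ∗-cong zero    p r = *-cong (p 0 z≤n) (r 0 z≤n)
  ∗-cong (suc n) p r = +-cong (*-cong (p 0 z≤n) (r (suc n) ℕₚ.≤-refl))
    (∗-cong n (λ k k≤n → p (suc k) (s≤s k≤n)) (λ k k≤n → r k (ℕₚ.m≤n⇒m≤1+n k≤n)))

  ∗-congˡ : ∀ n f {g g′} → (∀ k → g k ≈ g′ k) → (f ∗ g) n ≈ (f ∗ g′) n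
  ∗-congˡ n f p = ∗-cong n (λ _ _ → refl) (λ k _ → p k)

  ∗-congʳ : ∀ n {f f′} g → (∀ k → f k ≈ f′ k) → (f ∗ g) n ≈ (f′ ∗ g) n
  ∗-congʳ n g p = ∗-cong n (λ k _ → p k) (λ _ _ → refl)

  ∗-distribʳ : ∀ n h f g → ((λ k → f k + g k) ∗ h) n ≈ (f ∗ h) n + (g ∗ h) n
  ∗-distribʳ zero    h f g = distribʳ _ _ _
  ∗-distribʳ (suc n) h f g = trans (+-congˡ (∗-distribʳ n h (f ∘ suc) (g ∘ suc)))
    (solve 5 (λ f₀ g₀ x a b → (f₀ :+ g₀) :* x :+ (a :+ b) := (f₀ :* x :+ a) :+ (g₀ :* x :+ b))
      refl _ _ _ _ _)

  ∗-scaleˡ : ∀ n x f g → ((λ k → x * f k) ∗ g) n ≈ x * (f ∗ g) n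
  ∗-scaleˡ zero    x f g = *-assoc _ _ _
  ∗-scaleˡ (suc n) x f g = trans (+-congˡ (∗-scaleˡ n x (f ∘ suc) g))
    (solve 4 (λ x f₀ y a → x :* f₀ :* y :+ x :* a := x :* (f₀ :* y :+ a)) refl _ _ _ _)

  ∗-assoc : ∀ n f g h → ((f ∗ g) ∗ h) n ≈ (f ∗ (g ∗ h)) n
  ∗-assoc zero    f g h = *-assoc _ _ _
  ∗-assoc (suc n) f g h = begin
    f 0 * g 0 * h (suc n) + ((λ k → f 0 * g (suc k) + ((f ∘ suc) ∗ g) k) ∗ h) n
      ≈⟨ +-congˡ (∗-distribʳ n h (λ k → f 0 * g (suc k)) _) ⟩
    f 0 * g 0 * h (suc n) + (((λ k → f 0 * g (suc k)) ∗ h) n + (((f ∘ suc) ∗ g) ∗ h) n)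
      ≈⟨ +-congˡ (+-cong (∗-scaleˡ n (f 0) (g ∘ suc) h) (∗-assoc n (f ∘ suc) g h)) ⟩
    f 0 * g 0 * h (suc n) + (f 0 * ((g ∘ suc) ∗ h) n + ((f ∘ suc) ∗ (g ∗ h)) n)
      ≈⟨ solve 5 (λ f₀ g₀ x a b → f₀ :* g₀ :* x :+ (f₀ :* a :+ b) := f₀ :* (g₀ :* x :+ a) :+ b)
           refl _ _ _ _ _ ⟩
    f 0 * (g 0 * h (suc n) + ((g ∘ suc) ∗ h) n) + ((f ∘ suc) ∗ (g ∗ h)) n ∎

  -- Peeling from the other end is what the induction for commutativity needs.
  ∗-suc : ∀ n f g → (f ∗ g) (suc n) ≈ (f ∗ (g ∘ suc)) n + f (suc n) * g 0
  ∗-suc zero    f g = refl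
  ∗-suc (suc n) f g = trans (+-congˡ (∗-suc n (f ∘ suc) g)) (sym (+-assoc _ _ _))

  ∗-comm : ∀ n f g → (f ∗ g) n ≈ (g ∗ f) n
  ∗-comm zero    f g = *-comm _ _
  ∗-comm (suc n) f g = begin
    f 0 * g (suc n) + ((f ∘ suc) ∗ g) n  ≈⟨ +-cong (*-comm _ _) (∗-comm n (f ∘ suc) g) ⟩
    g (suc n) * f 0 + (g ∗ (f ∘ suc)) n  ≈⟨ +-comm _ _ ⟩
    (g ∗ (f ∘ suc)) n + g (suc n) * f 0  ≈⟨ ∗-suc n g f ⟨
    (g ∗ f) (suc n)                      ∎

  ∗-zeroˡ : ∀ n g → ((λ _ → 0#) ∗ g) n ≈ 0#
  ∗-zeroˡ zero    g = zeroˡ _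
  ∗-zeroˡ (suc n) g = trans (+-cong (zeroˡ _) (∗-zeroˡ n g)) (+-identityˡ _)

  ∗-identityˡ : ∀ n g → (δ ∗ g) n ≈ g n
  ∗-identityˡ zero    g = *-identityˡ _
  ∗-identityˡ (suc n) g = trans (+-cong (*-identityˡ _) (∗-zeroˡ n g)) (+-identityʳ _)

  ∗-distribˡ : ∀ n h f g → (h ∗ (λ k → f k + g k)) n ≈ (h ∗ f) n + (h ∗ g) n
  ∗-distribˡ n h f g = trans (∗-comm n h _)
    (trans (∗-distribʳ n h f g) (+-cong (∗-comm n f h) (∗-comm n g h)))

  ∗-identityʳ : ∀ n g → (g ∗ δ) n ≈ g n
  ∗-identityʳ n g = trans (∗-comm n g δ) (∗-identityˡ n g)

  -- Coefficients beyond N are ignored, which makes z nilpotent.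
  truncatedRing : ℕ → CommutativeRing c ℓ
  truncatedRing N = record
    { Carrier = ℕ → Carrier
    ; _≈_ = λ f g → ∀ n → n ≤ N → f n ≈ g n
    ; _+_ = λ f g n → f n + g n
    ; _*_ = _∗_
    ; -_ = λ f n → - f n
    ; 0# = λ _ → 0#
    ; 1# = δ
    ; isCommutativeRing = record
      { isRing = record
        { +-isAbelianGroup = record
          { isGroup = record
            { isMonoid = record
              { isSemigroup = record
                { isMagma = record
                  { isEquivalence = record
                    { refl = λ _ _ → refl
                    ; sym = λ p n n≤N → sym (p n n≤N)
                    ; trans = λ p r n n≤N → trans (p n n≤N) (r n n≤N)
                    }
                  ; ∙-cong = λ p r n n≤N → +-cong (p n n≤N) (r n n≤N)
                  }
                ; assoc = λ _ _ _ _ _ → +-assoc _ _ _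
                }
              ; identity = (λ _ _ _ → +-identityˡ _) , (λ _ _ _ → +-identityʳ _)
              }
            ; inverse = (λ _ _ _ → -‿inverseˡ _) , (λ _ _ _ → -‿inverseʳ _)
            ; ⁻¹-cong = λ p n n≤N → -‿cong (p n n≤N)
            }
          ; comm = λ _ _ _ _ → +-comm _ _
          }
        ; *-cong = λ p r n n≤N → ∗-cong n (λ k k≤n → p k (ℕₚ.≤-trans k≤n n≤N))
                                          (λ k k≤n → r k (ℕₚ.≤-trans k≤n n≤N))
        ; *-assoc = λ f g h n _ → ∗-assoc n f g h
        ; *-identity = (λ f n _ → ∗-identityˡ n f) , (λ f n _ → ∗-identityʳ n f)
        ; distrib = (λ h f g n _ → ∗-distribˡ n h f g) , (λ h f g n _ → ∗-distribʳ n h f g)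
        }
      ; *-comm = λ f g n _ → ∗-comm n f g
      }
    }

-- Triangular numbers j(j-1)/2 and the exponent of the double sum.

tri : ℕ → ℕ
tri zero    = 0
tri (suc j) = tri j ℕ.+ j

tri-square : ∀ j → j ℕ.* j ≡ 2 ℕ.* tri j ℕ.+ j
tri-square zero    = ≡.refl
tri-square (suc j) = ≡.trans (≡.cong (λ s → suc (j ℕ.+ s)) (≡.trans (ℕₚ.*-suc j j) (≡.cong (j ℕ.+_) (tri-square j))))
  (solve 2 (λ j t → con 1 :+ (j :+ (j :+ (con 2 :* t :+ j))) := con 2 :* (t :+ j) :+ (con 1 :+ j))
    ≡.refl j (tri j))
  where open +-*-Solver

-- Once (m+n)² is completed, the remainder depends on m alone. The unit coefficients are kept so
-- that it is literally the exponent in `eulerTerm 0 1 m`.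
expo-weight : ∀ m n → expo m n ≡
  ((m ℕ.+ n) ℕ.* (m ℕ.+ n) ℕ.+ 3 ℕ.* (m ℕ.+ n) ℕ.+ 1) ℕ.+ (1 ℕ.* tri m ℕ.+ 1 ℕ.* m)
expo-weight m n = begin
  3 ℕ.* ((m ℕ.* m ℕ.+ m) / 2) ℕ.+ 2 ℕ.* n ℕ.* m ℕ.+ n ℕ.* n ℕ.+ 3 ℕ.* n ℕ.+ 2 ℕ.* m ℕ.+ 1
    ≡⟨ ≡.cong (λ t → 3 ℕ.* t ℕ.+ 2 ℕ.* n ℕ.* m ℕ.+ n ℕ.* n ℕ.+ 3 ℕ.* n ℕ.+ 2 ℕ.* m ℕ.+ 1) half ⟩
  3 ℕ.* (tri m ℕ.+ m) ℕ.+ 2 ℕ.* n ℕ.* m ℕ.+ n ℕ.* n ℕ.+ 3 ℕ.* n ℕ.+ 2 ℕ.* m ℕ.+ 1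
    ≡⟨ solve 3 (λ m n t → con 3 :* (t :+ m) :+ con 2 :* n :* m :+ n :* n :+ con 3 :* n :+ con 2 :* m :+ con 1
         := (con 2 :* t :+ m) :+ (con 2 :* m :* n :+ n :* n :+ con 3 :* (m :+ n) :+ con 1 :+ t :+ m)) ≡.refl m n (tri m) ⟩
  (2 ℕ.* tri m ℕ.+ m) ℕ.+ (2 ℕ.* m ℕ.* n ℕ.+ n ℕ.* n ℕ.+ 3 ℕ.* (m ℕ.+ n) ℕ.+ 1 ℕ.+ tri m ℕ.+ m)
    ≡⟨ ≡.cong (ℕ._+ (2 ℕ.* m ℕ.* n ℕ.+ n ℕ.* n ℕ.+ 3 ℕ.* (m ℕ.+ n) ℕ.+ 1 ℕ.+ tri m ℕ.+ m)) (tri-square m) ⟨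
  m ℕ.* m ℕ.+ (2 ℕ.* m ℕ.* n ℕ.+ n ℕ.* n ℕ.+ 3 ℕ.* (m ℕ.+ n) ℕ.+ 1 ℕ.+ tri m ℕ.+ m)
    ≡⟨ solve 3 (λ m n t → m :* m :+ (con 2 :* m :* n :+ n :* n :+ con 3 :* (m :+ n) :+ con 1 :+ t :+ m)
         := ((m :+ n) :* (m :+ n) :+ con 3 :* (m :+ n) :+ con 1) :+ (con 1 :* t :+ con 1 :* m)) ≡.refl m n (tri m) ⟩
  ((m ℕ.+ n) ℕ.* (m ℕ.+ n) ℕ.+ 3 ℕ.* (m ℕ.+ n) ℕ.+ 1) ℕ.+ (1 ℕ.* tri m ℕ.+ 1 ℕ.* m) ∎
  where
  open ≡.≡-Reasoning
  open +-*-Solver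
  half : (m ℕ.* m ℕ.+ m) / 2 ≡ tri m ℕ.+ m
  half = ≡.trans (≡.cong (_/ 2) (≡.trans (≡.cong (ℕ._+ m) (tri-square m))
    (solve 2 (λ t m → con 2 :* t :+ m :+ m := (t :+ m) :* con 2) ≡.refl (tri m) m))) (m*n/n≡m (tri m ℕ.+ m) 2)

n/2≡⌊n/2⌋ : ∀ n → n / 2 ≡ ⌊ n /2⌋
n/2≡⌊n/2⌋ zero          = ≡.refl
n/2≡⌊n/2⌋ (suc zero)    = ≡.refl
n/2≡⌊n/2⌋ (suc (suc n)) = ≡.trans (m/n≡1+[m∸n]/n {suc (suc n)} {2} (s≤s (s≤s z≤n))) (≡.cong suc (n/2≡⌊n/2⌋ n))

-- Finite sums and summation along antidiagonals.

module Sums {c ℓ : Level} (R : CommutativeRing c ℓ) where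
  open CommutativeRing R
  open PowerSeries R
  open SetoidReasoning setoid
  open RingSolver commutativeSemiring using (solve; _:+_; _:*_; _:=_)

  ∑ : ℕ → (ℕ → Carrier) → Carrier
  ∑ zero    f = 0#
  ∑ (suc n) f = ∑ n f + f n

  ∑-cong : ∀ n {f g} → (∀ k → f k ≈ g k) → ∑ n f ≈ ∑ n g
  ∑-cong zero    p = refl
  ∑-cong (suc n) p = +-cong (∑-cong n p) (p n)

  ∑-suc : ∀ n f → ∑ (suc n) f ≈ f 0 + ∑ n (f ∘ suc)
  ∑-suc zero    f = +-comm _ _
  ∑-suc (suc n) f = trans (+-congʳ (∑-suc n f)) (+-assoc _ _ _)

  ∑-+ : ∀ n f g → ∑ n (λ k → f k + g k) ≈ ∑ n f + ∑ n g
  ∑-+ zero    f g = sym (+-identityˡ _)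
  ∑-+ (suc n) f g = trans (+-congʳ (∑-+ n f g))
    (solve 4 (λ a b c d → (a :+ b) :+ (c :+ d) := (a :+ c) :+ (b :+ d)) refl _ _ _ _)

  ∑-*ˡ : ∀ n x f → ∑ n (λ k → x * f k) ≈ x * ∑ n f
  ∑-*ˡ zero    x f = sym (zeroʳ _)
  ∑-*ˡ (suc n) x f = trans (+-congʳ (∑-*ˡ n x f)) (sym (distribˡ _ _ _))

  ∑-truncate : ∀ {m n} f → m ≤ n → (∀ k → m ≤ k → f k ≈ 0#) → ∑ n f ≈ ∑ m f
  ∑-truncate {m} {n} f m≤n f≈0 = go (ℕₚ.≤⇒≤′ m≤n)
    where
    go : ∀ {n} → m ℕ.≤′ n → ∑ n f ≈ ∑ m f
    go ℕ.≤′-refl       = refl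
    go (ℕ.≤′-step m≤n) = trans (+-cong (go m≤n) (f≈0 _ (ℕₚ.≤′⇒≤ m≤n))) (+-identityʳ _)

  -- Row i = 0 is peeled off and the shift passes into `w` and `a`, matching the recursion of `∗`.
  -- As `w` vanishes from m on, every antidiagonal that counts lies inside the rectangle; m falls in
  -- the induction while n stays, hence two bounds.
  ∑-antidiagonal : ∀ m n (w a b : ℕ → Carrier) → m ≤ n → (∀ r → m ≤ r → w r ≈ 0#) →
    ∑ m (λ i → ∑ n (λ j → w (i ℕ.+ j) * (a i * b j))) ≈ ∑ m (λ r → w r * (a ∗ b) r)
  ∑-antidiagonal zero    n w a b _   _   = refl
  ∑-antidiagonal (suc m) n w a b m<n w≈0 = begin
    ∑ (suc m) (λ i → ∑ n (λ j → w (i ℕ.+ j) * (a i * b j)))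
      ≈⟨ ∑-suc m _ ⟩
    ∑ n (λ j → w j * (a 0 * b j)) + ∑ m (λ i → ∑ n (λ j → w (suc (i ℕ.+ j)) * (a (suc i) * b j)))
      ≈⟨ +-cong (∑-truncate _ m<n (λ j m<j → trans (*-congʳ (w≈0 j m<j)) (zeroˡ _)))
                (∑-antidiagonal m n (w ∘ suc) (a ∘ suc) b (ℕₚ.<⇒≤ m<n) (λ r m≤r → w≈0 (suc r) (s≤s m≤r))) ⟩
    ∑ (suc m) (λ j → w j * (a 0 * b j)) + ∑ m (λ r → w (suc r) * ((a ∘ suc) ∗ b) r)
      ≈⟨ +-congʳ (∑-suc m _) ⟩
    (w 0 * (a 0 * b 0) + ∑ m (λ j → w (suc j) * (a 0 * b (suc j))))
      + ∑ m (λ r → w (suc r) * ((a ∘ suc) ∗ b) r)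
      ≈⟨ +-assoc _ _ _ ⟩
    w 0 * (a 0 * b 0) + (∑ m (λ j → w (suc j) * (a 0 * b (suc j)))
      + ∑ m (λ r → w (suc r) * ((a ∘ suc) ∗ b) r))
      ≈⟨ +-congˡ (∑-+ m _ _) ⟨
    w 0 * (a 0 * b 0) + ∑ m (λ r → w (suc r) * (a 0 * b (suc r)) + w (suc r) * ((a ∘ suc) ∗ b) r)
      ≈⟨ +-congˡ (∑-cong m (λ r → distribˡ _ _ _)) ⟨
    w 0 * (a 0 * b 0) + ∑ m (λ r → w (suc r) * (a ∗ b) (suc r))
      ≈⟨ ∑-suc m _ ⟨
    ∑ (suc m) (λ r → w r * (a ∗ b) r) ∎

-- geo k plays the role of 1/(1 - q^k); stating it as a fixed point avoids subtraction, and q^-large makes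
-- all infinite products stabilise at K.
record QPowers {c ℓ} (R : CommutativeRing c ℓ) (K : ℕ) : Set (c ⊔ ℓ) where
  open CommutativeRing R
  infix 9 q^_
  field
    q^_      : ℕ → Carrier
    geo      : ℕ → Carrier
    q^0      : q^ 0 ≈ 1#
    q^-+     : ∀ m n → q^ (m ℕ.+ n) ≈ q^ m * q^ n
    geo-eq   : ∀ k → geo (suc k) ≈ 1# + q^ (suc k) * geo (suc k)
    q^-large : ∀ e → K ≤ e → q^ e ≈ 0#

-- Geometric factors and finite q-products.

module QSeries {c ℓ : Level} (R : CommutativeRing c ℓ) (K : ℕ) (0<K : 0 < K) (Q : QPowers R K) where
  open CommutativeRing R
  open QPowers Q
  open PowerSeries R
  open Sums R
  open SetoidReasoning setoid
  open RingSolver commutativeSemiring using (solve; _:+_; _:*_; _:=_; con)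
  open +-*-Solver using () renaming (solve to solveℕ; _:+_ to _⊞_; _:*_ to _⊠_; _:=_ to _≔_; con to const)
  open AbelianGroupProperties +-abelianGroup using (∙-cancelʳ)

  q^-cong : ∀ {m n} → m ≡ n → q^ m ≈ q^ n
  q^-cong p = reflexive (≡.cong q^_ p)

  q^-cong₂ : ∀ k l m n → k ℕ.+ l ≡ m ℕ.+ n → q^ k * q^ l ≈ q^ m * q^ n
  q^-cong₂ k l m n p = trans (sym (q^-+ k l)) (trans (q^-cong p) (q^-+ m n))

  q^-split : ∀ k m n → k ≡ m ℕ.+ n → q^ k ≈ q^ m * q^ n
  q^-split k m n p = trans (q^-cong p) (q^-+ m n)

  geo-absorb : ∀ k x → x * geo (suc k) ≈ x + q^ (suc k) * (x * geo (suc k))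
  geo-absorb k x = trans (*-congˡ (geo-eq k))
    (solve 3 (λ x y g → x :* (con 1 :+ y :* g) := x :+ y :* (x :* g)) refl _ _ _)

  -- Multiplying the equation by `geo (suc k)` shows that every solution is `s * geo (suc k)`; this
  -- replaces division by 1 - q^(k+1).
  fixpoint-unique : ∀ k {s x y} → x ≈ s + q^ (suc k) * x → y ≈ s + q^ (suc k) * y → x ≈ y
  fixpoint-unique k {s} {x} {y} p r = trans (solution p) (sym (solution r))
    where
    g : Carrier
    g = geo (suc k)
    solution : ∀ {x} → x ≈ s + q^ (suc k) * x → x ≈ s * g
    solution {x} p = ∙-cancelʳ (q^ (suc k) * (x * g)) _ _ (begin
      x + q^ (suc k) * (x * g)        ≈⟨ geo-absorb k x ⟨
      x * g                           ≈⟨ *-congʳ p ⟩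
      (s + q^ (suc k) * x) * g        ≈⟨ solve 4 (λ s y x g → (s :+ y :* x) :* g := s :* g :+ y :* (x :* g)) refl _ _ _ _ ⟩
      s * g + q^ (suc k) * (x * g)    ∎)

  geo-cancel : ∀ k {x y} → x * geo (suc k) ≈ y * geo (suc k) → x ≈ y
  geo-cancel k {x} {y} p = ∙-cancelʳ (q^ (suc k) * (x * geo (suc k))) _ _ (begin
    x + q^ (suc k) * (x * geo (suc k))  ≈⟨ geo-absorb k x ⟨
    x * geo (suc k)                     ≈⟨ p ⟩
    y * geo (suc k)                     ≈⟨ geo-absorb k y ⟩
    y + q^ (suc k) * (y * geo (suc k))  ≈⟨ +-congˡ (*-congˡ p) ⟨
    y + q^ (suc k) * (x * geo (suc k))  ∎)

  -- 1/(1 - y) = (1 + y)/(1 - y²), because both sides solve x = 1 + yx.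
  geo-double : ∀ k → geo (suc k) ≈ (1# + q^ (suc k)) * geo (suc k ℕ.+ suc k)
  geo-double k = fixpoint-unique k (geo-eq k) (begin
    (1# + y) * g                ≈⟨ solve 2 (λ y g → (con 1 :+ y) :* g := g :+ y :* g) refl y g ⟩
    g + y * g                   ≈⟨ +-congʳ (geo-eq (k ℕ.+ suc k)) ⟩
    (1# + q^ (suc k ℕ.+ suc k) * g) + y * g  ≈⟨ +-congʳ (+-congˡ (*-congʳ (q^-+ (suc k) (suc k)))) ⟩
    (1# + (y * y) * g) + y * g
      ≈⟨ solve 2 (λ y g → (con 1 :+ (y :* y) :* g) :+ y :* g := con 1 :+ y :* ((con 1 :+ y) :* g)) refl y g ⟩
    1# + y * ((1# + y) * g)     ∎)
    where
    y g : Carrier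
    y = q^ (suc k)
    g = geo (suc k ℕ.+ suc k)

  geo-large : ∀ k → K ≤ suc k → geo (suc k) ≈ 1#
  geo-large k K≤k = trans (geo-eq k)
    (trans (+-congˡ (trans (*-congʳ (q^-large _ K≤k)) (zeroˡ _))) (+-identityʳ _))

  -- 1/(q^a;q^d)_n and (-q^a;q^d)_n.
  ip : ℕ → ℕ → ℕ → Carrier
  ip a d zero    = 1#
  ip a d (suc n) = ip a d n * geo (a ℕ.+ d ℕ.* n)

  pp : ℕ → ℕ → ℕ → Carrier
  pp a d zero    = 1#
  pp a d (suc n) = pp a d n * (1# + q^ (a ℕ.+ d ℕ.* n))

  ip-suc : ∀ a d n → ip (suc a) d (suc n) ≈ ip (suc a) d n + q^ (suc a ℕ.+ d ℕ.* n) * ip (suc a) d (suc n)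
  ip-suc a d n = geo-absorb (a ℕ.+ d ℕ.* n) (ip (suc a) d n)

  ip-cancel : ∀ a d n {x y} → x * ip (suc a) d n ≈ y * ip (suc a) d n → x ≈ y
  ip-cancel a d zero    p = trans (sym (*-identityʳ _)) (trans p (*-identityʳ _))
  ip-cancel a d (suc n) p = ip-cancel a d n (geo-cancel (a ℕ.+ d ℕ.* n)
    (trans (*-assoc _ _ _) (trans p (sym (*-assoc _ _ _)))))

  ip-split : ∀ a d n → ip a d (n ℕ.+ n) ≈ ip a (d ℕ.+ d) n * ip (a ℕ.+ d) (d ℕ.+ d) n
  ip-split a d zero    = sym (*-identityˡ _)
  ip-split a d (suc n) = begin
    ip a d (suc n ℕ.+ suc n)
      ≈⟨ reflexive (≡.cong (ip a d) (ℕₚ.+-suc (suc n) n)) ⟩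
    ip a d (n ℕ.+ n) * geo (a ℕ.+ d ℕ.* (n ℕ.+ n)) * geo (a ℕ.+ d ℕ.* suc (n ℕ.+ n))
      ≈⟨ *-cong (*-cong (ip-split a d n) (reflexive (≡.cong geo
           (solveℕ 3 (λ a d n → a ⊞ d ⊠ (n ⊞ n) ≔ a ⊞ (d ⊞ d) ⊠ n) ≡.refl a d n))))
           (reflexive (≡.cong geo
           (solveℕ 3 (λ a d n → a ⊞ d ⊠ (const 1 ⊞ (n ⊞ n)) ≔ a ⊞ d ⊞ (d ⊞ d) ⊠ n) ≡.refl a d n))) ⟩
    ip a (d ℕ.+ d) n * ip (a ℕ.+ d) (d ℕ.+ d) n * geo (a ℕ.+ (d ℕ.+ d) ℕ.* n)
      * geo (a ℕ.+ d ℕ.+ (d ℕ.+ d) ℕ.* n)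
      ≈⟨ solve 4 (λ p r g h → p :* r :* g :* h := (p :* g) :* (r :* h)) refl _ _ _ _ ⟩
    ip a (d ℕ.+ d) (suc n) * ip (a ℕ.+ d) (d ℕ.+ d) (suc n) ∎

  ip-stable : ∀ a d n → K ≤ n → ip (suc a) (suc d) (n ℕ.+ n) ≈ ip (suc a) (suc d) n
  ip-stable a d n K≤n = go n
    where
    go : ∀ m → ip (suc a) (suc d) (m ℕ.+ n) ≈ ip (suc a) (suc d) n
    go zero    = refl
    go (suc m) = trans (*-cong (go m) (geo-large _ (ℕₚ.≤-trans K≤n (ℕₚ.≤-trans (ℕₚ.m≤n+m n m)
      (ℕₚ.≤-trans (ℕₚ.m≤m+n (m ℕ.+ n) _) (ℕₚ.m≤n+m _ (suc a))))))) (*-identityʳ _)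

  -- Sorting 2K factors by the parity of their index fills both products on the right; on the left
  -- the factors past the first K are 1.
  ip-bisect : ∀ a d → ip (suc a) (suc d) K ≈
    ip (suc a) (suc d ℕ.+ suc d) K * ip (suc a ℕ.+ suc d) (suc d ℕ.+ suc d) K
  ip-bisect a d = trans (sym (ip-stable a d K ℕₚ.≤-refl)) (ip-split (suc a) (suc d) K)

  -- `geo-double` applied to each factor: the inverted form of (-a;Q)_n (a;Q)_n = (a²;Q²)_n.
  pp-ip : ∀ a d n → pp (suc a) d n * ip (suc a ℕ.+ suc a) (d ℕ.+ d) n ≈ ip (suc a) d n
  pp-ip a d zero    = *-identityˡ _
  pp-ip a d (suc n) = begin
    pp (suc a) d n * (1# + q^ (suc a ℕ.+ d ℕ.* n))
      * (ip (suc a ℕ.+ suc a) (d ℕ.+ d) n * geo (suc a ℕ.+ suc a ℕ.+ (d ℕ.+ d) ℕ.* n))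
      ≈⟨ solve 4 (λ p s r g → p :* s :* (r :* g) := (p :* r) :* (s :* g)) refl _ _ _ _ ⟩
    (pp (suc a) d n * ip (suc a ℕ.+ suc a) (d ℕ.+ d) n)
      * ((1# + q^ (suc a ℕ.+ d ℕ.* n)) * geo (suc a ℕ.+ suc a ℕ.+ (d ℕ.+ d) ℕ.* n))
      ≈⟨ *-cong (pp-ip a d n) (*-congˡ (reflexive (≡.cong geo
           (solveℕ 3 (λ a d n → a ⊞ a ⊞ (d ⊞ d) ⊠ n ≔ (a ⊞ d ⊠ n) ⊞ (a ⊞ d ⊠ n)) ≡.refl (suc a) d n)))) ⟩
    ip (suc a) d n * ((1# + q^ (suc a ℕ.+ d ℕ.* n)) * geo ((suc a ℕ.+ d ℕ.* n) ℕ.+ (suc a ℕ.+ d ℕ.* n)))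
      ≈⟨ *-congˡ (geo-double (a ℕ.+ d ℕ.* n)) ⟨
    ip (suc a) d n * geo (suc a ℕ.+ d ℕ.* n) ∎

  pp-concat : ∀ a d m n → pp a d (n ℕ.+ m) ≈ pp a d m * pp (a ℕ.+ d ℕ.* m) d n
  pp-concat a d m zero    = sym (*-identityʳ _)
  pp-concat a d m (suc n) = begin
    pp a d (n ℕ.+ m) * (1# + q^ (a ℕ.+ d ℕ.* (n ℕ.+ m)))
      ≈⟨ *-cong (pp-concat a d m n) (+-congˡ (q^-cong
           (solveℕ 4 (λ a d m n → a ⊞ d ⊠ (n ⊞ m) ≔ a ⊞ d ⊠ m ⊞ d ⊠ n) ≡.refl a d m n))) ⟩
    pp a d m * pp (a ℕ.+ d ℕ.* m) d n * (1# + q^ (a ℕ.+ d ℕ.* m ℕ.+ d ℕ.* n))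
      ≈⟨ *-assoc _ _ _ ⟩
    pp a d m * pp (a ℕ.+ d ℕ.* m) d (suc n) ∎

  pp-stable : ∀ a d m → pp a (suc d) (m ℕ.+ K) ≈ pp a (suc d) K
  pp-stable a d zero    = refl
  pp-stable a d (suc m) = trans
    (*-cong (pp-stable a d m) (trans (+-congˡ (q^-large _
      (ℕₚ.≤-trans (ℕₚ.m≤n+m K m) (ℕₚ.≤-trans (ℕₚ.m≤m+n (m ℕ.+ K) _) (ℕₚ.m≤n+m _ a))))) (+-identityʳ _)))
    (*-identityʳ _)

  -- Euler's identity for (-x;Q)_∞.

  -- Indices are shifted so that the base q^(d+1) is a proper power: with Q = q^(d+1) and x = q^e,
  -- this is Q^(j(j-1)/2) x^j / (Q;Q)_j.
  eulerTerm : ℕ → ℕ → ℕ → Carrier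
  eulerTerm d e j = q^ (suc d ℕ.* tri j ℕ.+ e ℕ.* j) * ip (suc d) (suc d) j

  eulerTerm-zero : ∀ d e → eulerTerm d e 0 ≈ 1#
  eulerTerm-zero d e = trans (*-identityʳ _)
    (trans (q^-cong (≡.cong₂ ℕ._+_ (ℕₚ.*-zeroʳ (suc d)) (ℕₚ.*-zeroʳ e))) q^0)

  -- Split 1/(Q;Q)_(j+1) into Q^(j+1)/(Q;Q)_(j+1) and 1/(Q;Q)_j: in the first part Q^(j+1) turns x
  -- into xQ, the second falls back to index j.
  eulerTerm-suc : ∀ d e j → eulerTerm d e (suc j) ≈
    eulerTerm d (e ℕ.+ suc d) (suc j) + q^ e * eulerTerm d (e ℕ.+ suc d) j
  eulerTerm-suc d e j = begin
    q^ x * ip (suc d) (suc d) (suc j)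
      ≈⟨ *-congˡ (ip-suc d (suc d) j) ⟩
    q^ x * (ip (suc d) (suc d) j + q^ y * ip (suc d) (suc d) (suc j))
      ≈⟨ solve 4 (λ x p y r → x :* (p :+ y :* r) := (x :* y) :* r :+ x :* p) refl _ _ _ _ ⟩
    (q^ x * q^ y) * ip (suc d) (suc d) (suc j) + q^ x * ip (suc d) (suc d) j
      ≈⟨ +-cong (*-congʳ (trans (sym (q^-+ x y)) (q^-cong
           (solveℕ 4 (λ d e t j → d ⊠ (t ⊞ j) ⊞ e ⊠ (const 1 ⊞ j) ⊞ (d ⊞ d ⊠ j)
             ≔ d ⊠ (t ⊞ j) ⊞ (e ⊞ d) ⊠ (const 1 ⊞ j)) ≡.refl (suc d) e (tri j) j))))
         (*-congʳ (q^-split x e _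
           (solveℕ 4 (λ d e t j → d ⊠ (t ⊞ j) ⊞ e ⊠ (const 1 ⊞ j)
             ≔ e ⊞ (d ⊠ t ⊞ (e ⊞ d) ⊠ j)) ≡.refl (suc d) e (tri j) j))) ⟩
    eulerTerm d (e ℕ.+ suc d) (suc j) + (q^ e * q^ (suc d ℕ.* tri j ℕ.+ (e ℕ.+ suc d) ℕ.* j)) * ip (suc d) (suc d) j
      ≈⟨ +-congˡ (*-assoc _ _ _) ⟩
    eulerTerm d (e ℕ.+ suc d) (suc j) + q^ e * eulerTerm d (e ℕ.+ suc d) j ∎
    where
    x y : ℕ
    x = suc d ℕ.* tri (suc j) ℕ.+ e ℕ.* suc j
    y = suc d ℕ.+ suc d ℕ.* j

  eulerTerm-large : ∀ d e j → K ≤ e ℕ.* j → eulerTerm d e j ≈ 0#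
  eulerTerm-large d e j K≤ej =
    trans (*-congʳ (q^-large _ (ℕₚ.≤-trans K≤ej (ℕₚ.m≤n+m (e ℕ.* j) _)))) (zeroˡ _)

  eulerSum : ℕ → ℕ → Carrier
  eulerSum d e = ∑ K (eulerTerm d e)

  -- Shifting the index brings in the term j = K, which vanishes because `suc e` is positive.
  eulerSum-suc : ∀ d e → 1# + ∑ K (eulerTerm d (suc e) ∘ suc) ≈ eulerSum d (suc e)
  eulerSum-suc d e = begin
    1# + ∑ K (eulerTerm d (suc e) ∘ suc)                     ≈⟨ +-congʳ (eulerTerm-zero d (suc e)) ⟨
    eulerTerm d (suc e) 0 + ∑ K (eulerTerm d (suc e) ∘ suc)  ≈⟨ ∑-suc K _ ⟨
    ∑ (suc K) (eulerTerm d (suc e))  ≈⟨ +-congˡ (eulerTerm-large d (suc e) K (ℕₚ.m≤m+n K _)) ⟩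
    eulerSum d (suc e) + 0#          ≈⟨ +-identityʳ _ ⟩
    eulerSum d (suc e)               ∎

  eulerSum-step : ∀ d e → eulerSum d (suc e) ≈ (1# + q^ (suc e)) * eulerSum d (suc e ℕ.+ suc d)
  eulerSum-step d e = begin
    eulerSum d (suc e)                         ≈⟨ eulerSum-suc d e ⟨
    1# + ∑ K (eulerTerm d (suc e) ∘ suc)       ≈⟨ +-congˡ (∑-cong K (eulerTerm-suc d (suc e))) ⟩
    1# + ∑ K (λ j → u (suc j) + y * u j)       ≈⟨ +-congˡ (∑-+ K _ _) ⟩
    1# + (∑ K (u ∘ suc) + ∑ K (λ j → y * u j)) ≈⟨ +-assoc _ _ _ ⟨
    (1# + ∑ K (u ∘ suc)) + ∑ K (λ j → y * u j) ≈⟨ +-cong (eulerSum-suc d (e ℕ.+ suc d)) (∑-*ˡ K y u) ⟩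
    ∑ K u + y * ∑ K u                          ≈⟨ solve 2 (λ s y → s :+ y :* s := (con 1 :+ y) :* s) refl _ _ ⟩
    (1# + y) * ∑ K u                           ∎
    where
    y : Carrier
    y = q^ (suc e)
    u : ℕ → Carrier
    u = eulerTerm d (suc e ℕ.+ suc d)

  eulerSum-iterate : ∀ d e n → eulerSum d (suc e) ≈ pp (suc e) (suc d) n * eulerSum d (suc e ℕ.+ suc d ℕ.* n)
  eulerSum-iterate d e zero    = trans (reflexive (≡.cong (eulerSum d)
    (solveℕ 2 (λ e d → e ≔ e ⊞ d ⊠ const 0) ≡.refl (suc e) (suc d)))) (sym (*-identityˡ _))
  eulerSum-iterate d e (suc n) = begin
    eulerSum d (suc e)
      ≈⟨ eulerSum-iterate d e n ⟩
    pp (suc e) (suc d) n * eulerSum d (suc e ℕ.+ suc d ℕ.* n)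
      ≈⟨ *-congˡ (eulerSum-step d (e ℕ.+ suc d ℕ.* n)) ⟩
    pp (suc e) (suc d) n * ((1# + q^ (suc e ℕ.+ suc d ℕ.* n)) * eulerSum d (suc e ℕ.+ suc d ℕ.* n ℕ.+ suc d))
      ≈⟨ *-assoc _ _ _ ⟨
    pp (suc e) (suc d) (suc n) * eulerSum d (suc e ℕ.+ suc d ℕ.* n ℕ.+ suc d)
      ≈⟨ *-congˡ (reflexive (≡.cong (eulerSum d)
           (solveℕ 3 (λ e d n → e ⊞ d ⊠ n ⊞ d ≔ e ⊞ d ⊠ (const 1 ⊞ n)) ≡.refl (suc e) (suc d) n))) ⟩
    pp (suc e) (suc d) (suc n) * eulerSum d (suc e ℕ.+ suc d ℕ.* suc n) ∎

  eulerSum-large : ∀ d e → K ≤ e → eulerSum d e ≈ 1#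
  eulerSum-large d e K≤e = begin
    -- `0<K` keeps the term j = 0 inside the sum.
    ∑ K (eulerTerm d e)   ≈⟨ ∑-truncate _ 0<K (λ { (suc j) _ → eulerTerm-large d e (suc j)
                               (ℕₚ.≤-trans K≤e (ℕₚ.m≤m*n e (suc j))) }) ⟩
    0# + eulerTerm d e 0  ≈⟨ +-identityˡ _ ⟩
    eulerTerm d e 0       ≈⟨ eulerTerm-zero d e ⟩
    1#                    ∎

  -- Iterating F(x) = (1 + x) F(xQ) K times produces the product and leaves F at an exponent of at
  -- least K, where only the constant term survives.
  euler : ∀ d e → eulerSum d (suc e) ≈ pp (suc e) (suc d) K
  euler d e = trans (eulerSum-iterate d e K)
    (trans (*-congˡ (eulerSum-large d _ (ℕₚ.≤-trans (ℕₚ.m≤m+n K _) (ℕₚ.m≤n+m _ (suc e))))) (*-identityʳ _))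

  -- Generating functions in z and their q-difference equations.

  -- Multiplication by 1 + xz and the substitution z ↦ q^k z in R[[z]].
  L : Carrier → (ℕ → Carrier) → ℕ → Carrier
  L x f zero    = f 0
  L x f (suc n) = f (suc n) + x * f n

  σ : ℕ → (ℕ → Carrier) → ℕ → Carrier
  σ k f n = q^ (k ℕ.* n) * f n

  L-cong : ∀ x {f g} → (∀ n → f n ≈ g n) → ∀ n → L x f n ≈ L x g n
  L-cong x p zero    = p 0
  L-cong x p (suc n) = +-cong (p (suc n)) (*-congˡ (p n))

  L-comm : ∀ x y f n → L x (L y f) n ≈ L y (L x f) n
  L-comm x y f zero          = refl
  L-comm x y f (suc zero)    =
    solve 4 (λ x y a b → (a :+ y :* b) :+ x :* b := (a :+ x :* b) :+ y :* b) refl _ _ _ _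
  L-comm x y f (suc (suc n)) =
    solve 5 (λ x y a b c → (a :+ y :* b) :+ x :* (b :+ y :* c) := (a :+ x :* b) :+ y :* (b :+ x :* c))
      refl _ _ _ _ _

  -- 1 + xz has constant coefficient 1, so it cancels one coefficient at a time.
  L-cancel : ∀ x {f g} → (∀ n → L x f n ≈ L x g n) → ∀ n → f n ≈ g n
  L-cancel x p zero    = p 0
  L-cancel x {f} {g} p (suc n) = ∙-cancelʳ (x * g n) _ _
    (trans (+-congˡ (*-congˡ (sym (L-cancel x p n)))) (p (suc n)))

  L-∗ : ∀ x f g n → (L x f ∗ g) n ≈ L x (f ∗ g) n
  L-∗ x f g zero    = refl
  L-∗ x f g (suc n) = trans
    (+-congˡ (trans (∗-distribʳ n g (f ∘ suc) (λ k → x * f k)) (+-congˡ (∗-scaleˡ n x f g))))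
    (sym (+-assoc _ _ _))

  ∗-L : ∀ x f g n → (f ∗ L x g) n ≈ L x (f ∗ g) n
  ∗-L x f g n = trans (∗-comm n f _) (trans (L-∗ x g f n) (L-cong x (λ k → ∗-comm k g f) n))

  σ-∗ : ∀ k f g n → (σ k f ∗ σ k g) n ≈ σ k (f ∗ g) n
  σ-∗ k f g zero    = begin
    (q^ (k ℕ.* 0) * f 0) * (q^ (k ℕ.* 0) * g 0)  ≈⟨ solve 3 (λ y a b → (y :* a) :* (y :* b) := y :* (y :* (a :* b))) refl _ _ _ ⟩
    q^ (k ℕ.* 0) * (q^ (k ℕ.* 0) * (f 0 * g 0))  ≈⟨ *-congʳ (trans (q^-cong (ℕₚ.*-zeroʳ k)) q^0) ⟩
    1# * (q^ (k ℕ.* 0) * (f 0 * g 0))            ≈⟨ *-identityˡ _ ⟩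
    q^ (k ℕ.* 0) * (f 0 * g 0)                   ∎
  σ-∗ k f g (suc n) = begin
    (q^ (k ℕ.* 0) * f 0) * (y * g (suc n)) + ((σ k f ∘ suc) ∗ σ k g) n
      ≈⟨ +-cong (*-congʳ (trans (*-congʳ (trans (q^-cong (ℕₚ.*-zeroʳ k)) q^0)) (*-identityˡ _)))
           -- Shifting `σ k f` by one index leaves a factor q^k, pulled out before the induction
           -- hypothesis applies.
           (trans (∗-congʳ n (σ k g) (λ j → trans (*-congʳ (q^-split _ k (k ℕ.* j) (ℕₚ.*-suc k j))) (*-assoc _ _ _)))
             (trans (∗-scaleˡ n (q^ k) (σ k (f ∘ suc)) (σ k g)) (*-congˡ (σ-∗ k (f ∘ suc) g n)))) ⟩
    f 0 * (y * g (suc n)) + q^ k * (q^ (k ℕ.* n) * ((f ∘ suc) ∗ g) n)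
      ≈⟨ +-congˡ (trans (sym (*-assoc _ _ _)) (*-congʳ (sym (q^-split _ k (k ℕ.* n) (ℕₚ.*-suc k n))))) ⟩
    f 0 * (y * g (suc n)) + y * ((f ∘ suc) ∗ g) n
      ≈⟨ solve 4 (λ a y b c → a :* (y :* b) :+ y :* c := y :* (a :* b :+ c)) refl _ _ _ _ ⟩
    y * (f 0 * g (suc n) + ((f ∘ suc) ∗ g) n) ∎
    where
    y : Carrier
    y = q^ (k ℕ.* suc n)

  -- Subtraction takes the form `- 1# * y` found in `L (- 1#)`; the semiring solver treats `- 1#` as
  -- a variable.
  x≈y+z⇒x-y≈z : ∀ {x y z} → x ≈ y + z → x + - 1# * y ≈ z
  x≈y+z⇒x-y≈z {x} {y} {z} p = begin
    x + - 1# * y        ≈⟨ +-congʳ p ⟩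
    (y + z) + - 1# * y  ≈⟨ solve 3 (λ y z m → (y :+ z) :+ m :* y := (con 1 :+ m) :* y :+ z) refl y z (- 1#) ⟩
    (1# + - 1#) * y + z ≈⟨ +-congʳ (trans (*-congʳ (-‿inverseʳ 1#)) (zeroˡ y)) ⟩
    0# + z              ≈⟨ +-identityˡ z ⟩
    z                   ∎

  x-y≈z⇒x≈y+z : ∀ {x y z} → x + - 1# * y ≈ z → x ≈ y + z
  x-y≈z⇒x≈y+z {x} {y} {z} p = begin
    x                     ≈⟨ +-identityˡ x ⟨
    0# + x                ≈⟨ +-congʳ (trans (*-congʳ (-‿inverseʳ 1#)) (zeroˡ y)) ⟨
    (1# + - 1#) * y + x   ≈⟨ solve 3 (λ y x m → (con 1 :+ m) :* y :+ x := y :+ (x :+ m :* y)) refl y x (- 1#) ⟩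
    y + (x + - 1# * y)    ≈⟨ +-congˡ p ⟩
    y + z                 ∎

  -- (1 - z) X(z) = (1 + qz) X(q²z), the functional equation of (-qz;q²)_∞ / (z;q²)_∞.
  FunctionalEquation : (ℕ → Carrier) → Set ℓ
  FunctionalEquation f = ∀ n → L (- 1#) f n ≈ L (q^ 1) (σ 2 f) n

  -- The coefficients satisfy (1 - q^(2n+2)) f(n+1) = (1 + q^(2n+1)) f(n), so each determines the
  -- next.
  functionalEquation-unique : ∀ {f g} → f 0 ≈ g 0 → FunctionalEquation f → FunctionalEquation g →
                              ∀ n → f n ≈ g n
  functionalEquation-unique p _ _ zero = p
  -- `n ℕ.+ 1 ℕ.* suc n` is the predecessor of `2 ℕ.* suc n`, the exponent in the recursion.
  functionalEquation-unique {f} {g} p φ γ (suc n) = fixpoint-unique (n ℕ.+ 1 ℕ.* suc n)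
    (trans (rearranged φ) (+-congʳ (+-cong ih (*-congˡ (*-congˡ ih))))) (rearranged γ)
    where
    ih : f n ≈ g n
    ih = functionalEquation-unique p φ γ n
    rearranged : ∀ {h} → FunctionalEquation h →
      h (suc n) ≈ (h n + q^ 1 * (q^ (2 ℕ.* n) * h n)) + q^ (2 ℕ.* suc n) * h (suc n)
    rearranged η = trans (x-y≈z⇒x≈y+z (η (suc n)))
      (solve 3 (λ a b c → a :+ (b :+ c) := (a :+ c) :+ b) refl _ _ _)

  σ-eulerTerm : ∀ k d e n → σ k (eulerTerm d e) n ≈ eulerTerm d (e ℕ.+ k) n
  σ-eulerTerm k d e n = trans (sym (*-assoc _ _ _)) (*-congʳ (trans (sym (q^-+ _ _)) (q^-cong
    (solveℕ 5 (λ k d t e n → k ⊠ n ⊞ (d ⊠ t ⊞ e ⊠ n) ≔ d ⊠ t ⊞ (e ⊞ k) ⊠ n) ≡.refl k (suc d) (tri n) e n))))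

  -- The generating function of the Euler terms is (-xz;Q)_∞, from which the first factor 1 + xz
  -- splits off.
  eulerTerm-L : ∀ d e n → eulerTerm d e n ≈ L (q^ e) (eulerTerm d (e ℕ.+ suc d)) n
  eulerTerm-L d e zero    = trans (eulerTerm-zero d e) (sym (eulerTerm-zero d (e ℕ.+ suc d)))
  eulerTerm-L d e (suc n) = eulerTerm-suc d e n

  -- The series is 1/(z;q²)_∞, whose first factor is removed by 1 - z.
  ip-L : ∀ n → L (- 1#) (ip 2 2) n ≈ σ 2 (ip 2 2) n
  ip-L zero    = sym (trans (*-identityʳ _) q^0)
  ip-L (suc n) = x≈y+z⇒x-y≈z (trans (ip-suc 1 2 n) (+-congˡ (*-congʳ (q^-cong (≡.sym (ℕₚ.*-suc 2 n))))))

  -- Coefficients of (1 + z)/(z²;q⁴)_∞.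
  halfIp : ℕ → Carrier
  halfIp n = ip 4 4 ⌊ n /2⌋

  private
    -- (1 - z)(1 + q²z) B(z) = B(q²z) for B = Σ c ⌊n/2⌋ z^n; s absorbs the shift of c in the induction.
    half-recurrence : ∀ s (c : ℕ → Carrier) → (∀ k → c (suc k) ≈ c k + q^ (s ℕ.+ 4 ℕ.* k) * c (suc k)) →
      ∀ n → c ⌊ suc (suc n) /2⌋ + q^ 2 * c ⌊ suc n /2⌋
          ≈ (c ⌊ suc n /2⌋ + q^ 2 * c ⌊ n /2⌋) + q^ (s ℕ.+ 2 ℕ.* n) * c ⌊ suc (suc n) /2⌋
    half-recurrence s c p zero = trans (+-congʳ (p 0))
      (solve 3 (λ a b y → (a :+ b) :+ y := (a :+ y) :+ b) refl _ _ _)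
    half-recurrence s c p (suc zero) = trans (+-congˡ (trans (*-congˡ (p 0))
      (distribˡ _ _ _))) (trans (sym (+-assoc _ _ _)) (+-congˡ (trans (sym (*-assoc _ _ _)) (*-congʳ
      (trans (sym (q^-+ 2 _)) (q^-cong (solveℕ 1 (λ s → const 2 ⊞ (s ⊞ const 0) ≔ s ⊞ const 2) ≡.refl s)))))))
    half-recurrence s c p (suc (suc n)) = trans
      (half-recurrence (s ℕ.+ 4) (c ∘ suc) (λ k → trans (p (suc k)) (+-congˡ (*-congʳ (q^-cong
        (solveℕ 2 (λ s k → s ⊞ const 4 ⊠ (const 1 ⊞ k) ≔ s ⊞ const 4 ⊞ const 4 ⊠ k) ≡.refl s k))))) n)
      (+-congˡ (*-congʳ (q^-cong
        (solveℕ 2 (λ s n → s ⊞ const 4 ⊞ const 2 ⊠ n ≔ s ⊞ const 2 ⊠ (const 2 ⊞ n)) ≡.refl s n))))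

  -- For B(z) = (1 + z)/(z²;q⁴)_∞, multiplication by 1 - z cancels the factor 1 - z² and leaves
  -- 1/(q⁴z²;q⁴)_∞; the factor 1 + q²z then completes B(q²z).
  halfIp-L : ∀ n → L (q^ 2) (L (- 1#) halfIp) n ≈ σ 2 halfIp n
  halfIp-L zero       = sym (trans (*-congʳ q^0) (*-identityˡ _))
  halfIp-L (suc zero) = trans (+-congʳ (x≈y+z⇒x-y≈z (sym (+-identityʳ _)))) (+-identityˡ _)
  halfIp-L (suc (suc n)) = begin
    (b₂ + - 1# * b₁) + q^ 2 * (b₁ + - 1# * b₀)
      ≈⟨ solve 5 (λ x y z m w → (x :+ m :* y) :+ w :* (y :+ m :* z) := (x :+ w :* y) :+ m :* (y :+ w :* z))
           refl b₂ b₁ b₀ (- 1#) (q^ 2) ⟩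
    (b₂ + q^ 2 * b₁) + - 1# * (b₁ + q^ 2 * b₀)
      ≈⟨ x≈y+z⇒x-y≈z (half-recurrence 4 (ip 4 4) (ip-suc 3 4) n) ⟩
    q^ (4 ℕ.+ 2 ℕ.* n) * b₂
      ≈⟨ *-congʳ (q^-cong (solveℕ 1 (λ n → const 4 ⊞ const 2 ⊠ n ≔ const 2 ⊠ (const 2 ⊞ n)) ≡.refl n)) ⟩
    q^ (2 ℕ.* suc (suc n)) * b₂ ∎
    where
    b₀ b₁ b₂ : Carrier
    b₀ = halfIp n
    b₁ = halfIp (suc n)
    b₂ = halfIp (suc (suc n))

  -- For A(z) = (-qz;q)_∞ one has A(z) = (1 + qz)(1 + q²z) A(q²z), while (1 - z) B(z) needs a factor
  -- 1 + q²z to become B(q²z). So the equation is proved multiplied by 1 + q²z, which then cancels.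
  functionalEquation-half : FunctionalEquation (eulerTerm 0 1 ∗ halfIp)
  functionalEquation-half = L-cancel (q^ 2) (λ n → begin
    L (q^ 2) (L (- 1#) (a ∗ halfIp)) n        ≈⟨ L-cong (q^ 2) (λ k → sym (∗-L (- 1#) a halfIp k)) n ⟩
    L (q^ 2) (a ∗ L (- 1#) halfIp) n          ≈⟨ ∗-L (q^ 2) a _ n ⟨
    (a ∗ L (q^ 2) (L (- 1#) halfIp)) n        ≈⟨ ∗-congˡ n a halfIp-L ⟩
    (a ∗ σ 2 halfIp) n                        ≈⟨ ∗-congʳ n (σ 2 halfIp) a-L ⟩
    (L (q^ 1) (L (q^ 2) (σ 2 a)) ∗ σ 2 halfIp) n
      ≈⟨ trans (L-∗ (q^ 1) _ _ n) (L-cong (q^ 1) (L-∗ (q^ 2) _ _) n) ⟩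
    L (q^ 1) (L (q^ 2) (σ 2 a ∗ σ 2 halfIp)) n ≈⟨ L-comm (q^ 1) (q^ 2) _ n ⟩
    L (q^ 2) (L (q^ 1) (σ 2 a ∗ σ 2 halfIp)) n ≈⟨ L-cong (q^ 2) (L-cong (q^ 1) (σ-∗ 2 a halfIp)) n ⟩
    L (q^ 2) (L (q^ 1) (σ 2 (a ∗ halfIp))) n   ∎)
    where
    a : ℕ → Carrier
    a = eulerTerm 0 1
    a-L : ∀ n → a n ≈ L (q^ 1) (L (q^ 2) (σ 2 a)) n
    a-L n = trans (eulerTerm-L 0 1 n) (L-cong (q^ 1) (λ k → trans (eulerTerm-L 0 2 k)
      (L-cong (q^ 2) (λ j → sym (σ-eulerTerm 2 0 1 j)) k)) n)

  functionalEquation-full : FunctionalEquation (eulerTerm 1 1 ∗ ip 2 2)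
  functionalEquation-full n = begin
    L (- 1#) (a ∗ ip 2 2) n            ≈⟨ ∗-L (- 1#) a (ip 2 2) n ⟨
    (a ∗ L (- 1#) (ip 2 2)) n          ≈⟨ ∗-congˡ n a ip-L ⟩
    (a ∗ σ 2 (ip 2 2)) n               ≈⟨ ∗-congʳ n (σ 2 (ip 2 2)) (λ k → trans (eulerTerm-L 1 1 k)
                                            (L-cong (q^ 1) (λ j → sym (σ-eulerTerm 2 1 1 j)) k)) ⟩
    (L (q^ 1) (σ 2 a) ∗ σ 2 (ip 2 2)) n ≈⟨ L-∗ (q^ 1) _ _ n ⟩
    L (q^ 1) (σ 2 a ∗ σ 2 (ip 2 2)) n   ≈⟨ L-cong (q^ 1) (σ-∗ 2 a (ip 2 2)) n ⟩
    L (q^ 1) (σ 2 (a ∗ ip 2 2)) n       ∎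
    where
    a : ℕ → Carrier
    a = eulerTerm 1 1

  -- Both sides solve one q-difference equation with the same constant coefficient, so no infinite
  -- product in z has to be formed.
  half≈full : ∀ n → (eulerTerm 0 1 ∗ halfIp) n ≈ (eulerTerm 1 1 ∗ ip 2 2) n
  half≈full = functionalEquation-unique
    (*-congʳ (trans (eulerTerm-zero 0 1) (sym (eulerTerm-zero 1 1))))
    functionalEquation-half functionalEquation-full

  -- The double sum as a difference of Euler products.

  weight : ℕ → Carrier
  weight r = q^ (r ℕ.* r ℕ.+ 3 ℕ.* r ℕ.+ 1)

  weight-large : ∀ r → K ≤ r → weight r ≈ 0#
  weight-large r K≤r = q^-large _ (ℕₚ.≤-trans K≤r (ℕₚ.≤-trans (ℕₚ.m≤m+n r _)
    (ℕₚ.≤-trans (ℕₚ.m≤n+m (3 ℕ.* r) (r ℕ.* r)) (ℕₚ.m≤m+n _ 1))))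

  term-weight : ∀ m n → q^ (expo m n) * ip 1 1 m * ip 4 4 (n / 2) ≈
                weight (m ℕ.+ n) * (eulerTerm 0 1 m * halfIp n)
  term-weight m n = begin
    q^ (expo m n) * ip 1 1 m * ip 4 4 (n / 2)
      ≈⟨ *-cong (*-congʳ (q^-split _ _ _ (expo-weight m n))) (reflexive (≡.cong (ip 4 4) (n/2≡⌊n/2⌋ n))) ⟩
    (weight (m ℕ.+ n) * q^ (1 ℕ.* tri m ℕ.+ 1 ℕ.* m)) * ip 1 1 m * halfIp n
      ≈⟨ solve 4 (λ w x p h → (w :* x) :* p :* h := w :* ((x :* p) :* h)) refl _ _ _ _ ⟩
    weight (m ℕ.+ n) * (eulerTerm 0 1 m * halfIp n) ∎

  -- The cross term 2kj of (k+j)² goes into the argument q^(4+2k) of an Euler term in j. What is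
  -- left involves k only and carries the exponent of `eulerTerm 3 1 (suc k)`.
  weight-split : ∀ k j → weight (k ℕ.+ j) * (eulerTerm 1 1 k * ip 2 2 j) ≈
    (q^ (4 ℕ.* tri (suc k) ℕ.+ 1 ℕ.* suc k) * ip 2 2 k) * eulerTerm 1 (4 ℕ.+ 2 ℕ.* k) j
  weight-split k j = begin
    q^ w * ((q^ x * ip 2 2 k) * ip 2 2 j)
      ≈⟨ solve 4 (λ w x p r → w :* ((x :* p) :* r) := (w :* x) :* (p :* r)) refl _ _ _ _ ⟩
    (q^ w * q^ x) * (ip 2 2 k * ip 2 2 j)
      ≈⟨ *-congʳ (q^-cong₂ w x y z exponents) ⟩
    (q^ y * q^ z) * (ip 2 2 k * ip 2 2 j)
      ≈⟨ solve 4 (λ y z p r → (y :* z) :* (p :* r) := (y :* p) :* (z :* r)) refl _ _ _ _ ⟩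
    (q^ y * ip 2 2 k) * (q^ z * ip 2 2 j) ∎
    where
    w x y z : ℕ
    w = (k ℕ.+ j) ℕ.* (k ℕ.+ j) ℕ.+ 3 ℕ.* (k ℕ.+ j) ℕ.+ 1
    x = 2 ℕ.* tri k ℕ.+ 1 ℕ.* k
    y = 4 ℕ.* tri (suc k) ℕ.+ 1 ℕ.* suc k
    z = 2 ℕ.* tri j ℕ.+ (4 ℕ.+ 2 ℕ.* k) ℕ.* j
    exponents : w ℕ.+ x ≡ y ℕ.+ z
    exponents = ≡.trans
      (solveℕ 3 (λ k j t → ((k ⊞ j) ⊠ (k ⊞ j) ⊞ const 3 ⊠ (k ⊞ j) ⊞ const 1) ⊞ (const 2 ⊠ t ⊞ const 1 ⊠ k)
        ≔ (k ⊠ k ⊞ j ⊠ j) ⊞ (const 2 ⊠ k ⊠ j ⊞ const 3 ⊠ j ⊞ const 4 ⊠ k ⊞ const 1 ⊞ const 2 ⊠ t))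
        ≡.refl k j (tri k))
      -- Squares are traded for triangular numbers between two solver calls, since the solver knows
      -- no relation between `k ℕ.* k` and `tri k`.
      (≡.trans (≡.cong (ℕ._+ (2 ℕ.* k ℕ.* j ℕ.+ 3 ℕ.* j ℕ.+ 4 ℕ.* k ℕ.+ 1 ℕ.+ 2 ℕ.* tri k))
        (≡.cong₂ ℕ._+_ (tri-square k) (tri-square j)))
      (solveℕ 4 (λ k j t u →
        ((const 2 ⊠ t ⊞ k) ⊞ (const 2 ⊠ u ⊞ j)) ⊞ (const 2 ⊠ k ⊠ j ⊞ const 3 ⊠ j ⊞ const 4 ⊠ k ⊞ const 1 ⊞ const 2 ⊠ t)
        ≔ (const 4 ⊠ (t ⊞ k) ⊞ const 1 ⊠ (const 1 ⊞ k)) ⊞ (const 2 ⊠ u ⊞ (const 4 ⊞ const 2 ⊠ k) ⊠ j))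
        ≡.refl k j (tri k) (tri j)))

  doubleSum : Carrier
  doubleSum = ∑ K (λ m → ∑ K (λ n → q^ (expo m n) * ip 1 1 m * ip 4 4 (n / 2)))

  outerTerm : ℕ → Carrier
  outerTerm k = (q^ (4 ℕ.* tri (suc k) ℕ.+ 1 ℕ.* suc k) * ip 2 2 k) * pp (4 ℕ.+ 2 ℕ.* k) 2 K

  doubleSum-outer : doubleSum ≈ ∑ K outerTerm
  doubleSum-outer = begin
    doubleSum
      ≈⟨ ∑-cong K (λ m → ∑-cong K (term-weight m)) ⟩
    ∑ K (λ m → ∑ K (λ n → weight (m ℕ.+ n) * (eulerTerm 0 1 m * halfIp n)))
      ≈⟨ ∑-antidiagonal K K weight (eulerTerm 0 1) halfIp ℕₚ.≤-refl weight-large ⟩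
    ∑ K (λ r → weight r * (eulerTerm 0 1 ∗ halfIp) r)
      ≈⟨ ∑-cong K (λ r → *-congˡ (half≈full r)) ⟩
    ∑ K (λ r → weight r * (eulerTerm 1 1 ∗ ip 2 2) r)
      -- The regrouping is undone with the new factorisation, whose inner sum over j is an Euler
      -- sum.
      ≈⟨ ∑-antidiagonal K K weight (eulerTerm 1 1) (ip 2 2) ℕₚ.≤-refl weight-large ⟨
    ∑ K (λ k → ∑ K (λ j → weight (k ℕ.+ j) * (eulerTerm 1 1 k * ip 2 2 j)))
      ≈⟨ ∑-cong K (λ k → trans (∑-cong K (weight-split k))
           (trans (∑-*ˡ K _ (eulerTerm 1 (4 ℕ.+ 2 ℕ.* k))) (*-congˡ (euler 1 (3 ℕ.+ 2 ℕ.* k))))) ⟩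
    ∑ K outerTerm ∎

  -- By `pp-ip`, 1/(q²;q²)_(k+1) = (-q²;q²)_(k+1)/(q⁴;q⁴)_(k+1), and this head joins the tail
  -- (-q^(2k+4);q²)_∞ to the full product.
  pp-tail : ∀ k → ip 2 2 (suc k) * pp (4 ℕ.+ 2 ℕ.* k) 2 K ≈ pp 2 2 K * ip 4 4 (suc k)
  pp-tail k = begin
    ip 2 2 (suc k) * pp (4 ℕ.+ 2 ℕ.* k) 2 K
      ≈⟨ *-cong (pp-ip 1 2 (suc k)) (reflexive (≡.cong (λ a → pp a 2 K)
           (solveℕ 1 (λ k → const 2 ⊞ const 2 ⊠ (const 1 ⊞ k) ≔ const 4 ⊞ const 2 ⊠ k) ≡.refl k))) ⟨
    (pp 2 2 (suc k) * ip 4 4 (suc k)) * pp (2 ℕ.+ 2 ℕ.* suc k) 2 K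
      ≈⟨ solve 3 (λ p r s → (p :* r) :* s := (p :* s) :* r) refl _ _ _ ⟩
    (pp 2 2 (suc k) * pp (2 ℕ.+ 2 ℕ.* suc k) 2 K) * ip 4 4 (suc k)
      ≈⟨ *-congʳ (trans (sym (pp-concat 2 2 (suc k) K))
           (trans (reflexive (≡.cong (pp 2 2) (ℕₚ.+-comm K (suc k)))) (pp-stable 2 1 (suc k)))) ⟩
    pp 2 2 K * ip 4 4 (suc k) ∎

  -- 1/((q²;q²)_k (-q²;q²)_(k+1)) = (1 - q^(2k+2))/(q⁴;q⁴)_(k+1), with the subtracted part moved to the left.
  outerTerm-telescope : ∀ k → outerTerm k + pp 2 2 K * eulerTerm 3 3 (suc k) ≈ pp 2 2 K * eulerTerm 3 1 (suc k)
  outerTerm-telescope k = begin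
    (q^ x * ip 2 2 k) * s + P * (q^ y * ip 4 4 (suc k))
      ≈⟨ +-congˡ (*-congˡ (*-congʳ (q^-split y x (2 ℕ.+ 2 ℕ.* k)
           (solveℕ 2 (λ t k → const 4 ⊠ t ⊞ const 3 ⊠ (const 1 ⊞ k)
             ≔ (const 4 ⊠ t ⊞ const 1 ⊠ (const 1 ⊞ k)) ⊞ (const 2 ⊞ const 2 ⊠ k)) ≡.refl (tri (suc k)) k)))) ⟩
    (q^ x * ip 2 2 k) * s + P * ((q^ x * u) * ip 4 4 (suc k))
      ≈⟨ solve 6 (λ x p s P u r → (x :* p) :* s :+ P :* ((x :* u) :* r) := x :* (p :* s :+ u :* (P :* r)))
           refl _ _ _ _ _ _ ⟩
    q^ x * (ip 2 2 k * s + u * (P * ip 4 4 (suc k)))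
      ≈⟨ *-congˡ (+-congˡ (*-congˡ (pp-tail k))) ⟨
    q^ x * (ip 2 2 k * s + u * (ip 2 2 (suc k) * s))
      ≈⟨ *-congˡ (solve 4 (λ p s u r → p :* s :+ u :* (r :* s) := (p :+ u :* r) :* s) refl _ _ _ _) ⟩
    q^ x * ((ip 2 2 k + u * ip 2 2 (suc k)) * s)
      ≈⟨ *-congˡ (*-congʳ (ip-suc 1 2 k)) ⟨
    q^ x * (ip 2 2 (suc k) * s)
      ≈⟨ *-congˡ (pp-tail k) ⟩
    q^ x * (P * ip 4 4 (suc k))
      ≈⟨ solve 3 (λ x P r → x :* (P :* r) := P :* (x :* r)) refl _ _ _ ⟩
    P * (q^ x * ip 4 4 (suc k)) ∎
    where
    x y : ℕ
    x = 4 ℕ.* tri (suc k) ℕ.+ 1 ℕ.* suc k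
    y = 4 ℕ.* tri (suc k) ℕ.+ 3 ℕ.* suc k
    s P u : Carrier
    s = pp (4 ℕ.+ 2 ℕ.* k) 2 K
    P = pp 2 2 K
    u = q^ (2 ℕ.+ 2 ℕ.* k)

  -- `outerTerm-telescope` accounts for the terms j ≥ 1 of two Euler sums in base q⁴; adding P =
  -- (-q²;q²)_∞ on both sides supplies their j = 0 terms.
  doubleSum-pp : doubleSum + pp 2 2 K * pp 3 4 K ≈ pp 2 2 K * pp 1 4 K
  doubleSum-pp = begin
    doubleSum + P * pp 3 4 K
      ≈⟨ +-cong doubleSum-outer (*-congˡ (sym (trans (eulerSum-suc 3 2) (euler 3 2)))) ⟩
    ∑ K outerTerm + P * (1# + ∑ K v)
      ≈⟨ solve 3 (λ t P v → t :+ P :* (con 1 :+ v) := P :+ (t :+ P :* v)) refl _ _ _ ⟩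
    P + (∑ K outerTerm + P * ∑ K v)
      ≈⟨ +-congˡ (trans (∑-+ K _ _) (+-congˡ (∑-*ˡ K P v))) ⟨
    P + ∑ K (λ k → outerTerm k + P * v k)
      ≈⟨ +-congˡ (trans (∑-cong K outerTerm-telescope) (∑-*ˡ K P _)) ⟩
    P + P * ∑ K (eulerTerm 3 1 ∘ suc)
      ≈⟨ solve 2 (λ P v → P :+ P :* v := P :* (con 1 :+ v)) refl _ _ ⟩
    P * (1# + ∑ K (eulerTerm 3 1 ∘ suc))
      ≈⟨ *-congˡ (trans (eulerSum-suc 3 0) (euler 3 0)) ⟩
    P * pp 1 4 K ∎
    where
    P : Carrier
    P = pp 2 2 K
    v : ℕ → Carrier
    v = eulerTerm 3 3 ∘ suc

  -- Conversion of the products to base q⁸.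

  -- Euler's odd-distinct theorem in base q².
  pp-odd : pp 2 2 K ≈ ip 2 8 K * ip 6 8 K
  pp-odd = trans (ip-cancel 3 4 K (trans (pp-ip 1 2 K) (ip-bisect 1 1))) (ip-bisect 1 3)

  -- Of the two factors of `pp-odd`, (-q³;q⁴)_∞ absorbs 1/(q⁶;q⁸)_∞ and (-q;q⁴)_∞ absorbs
  -- 1/(q²;q⁸)_∞. This gives 1/(q³;q⁴)_∞ and 1/(q;q⁴)_∞, which `ip-bisect` splits modulo 8.
  doubleSum-ip : doubleSum + ip 2 8 K * ip 3 8 K * ip 7 8 K ≈ ip 1 8 K * ip 5 8 K * ip 6 8 K
  doubleSum-ip = begin
    doubleSum + ip 2 8 K * ip 3 8 K * ip 7 8 K
      ≈⟨ +-congˡ (trans (*-assoc _ _ _) (*-congˡ (sym (ip-bisect 2 3)))) ⟩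
    doubleSum + ip 2 8 K * ip 3 4 K
      ≈⟨ +-congˡ (*-congˡ (pp-ip 2 4 K)) ⟨
    doubleSum + ip 2 8 K * (pp 3 4 K * ip 6 8 K)
      ≈⟨ +-congˡ (trans (solve 3 (λ a b c → a :* (b :* c) := (a :* c) :* b) refl _ _ _) (*-congʳ (sym pp-odd))) ⟩
    doubleSum + pp 2 2 K * pp 3 4 K
      ≈⟨ doubleSum-pp ⟩
    pp 2 2 K * pp 1 4 K
      ≈⟨ trans (*-congʳ pp-odd) (solve 3 (λ a b c → (a :* b) :* c := (c :* a) :* b) refl _ _ _) ⟩
    (pp 1 4 K * ip 2 8 K) * ip 6 8 K
      ≈⟨ *-congʳ (trans (pp-ip 0 4 K) (ip-bisect 0 3)) ⟩
    ip 1 8 K * ip 5 8 K * ip 6 8 K ∎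

-- Integer series and monomials as an instance of `QPowers`.

module _ where
  open PowerSeries ℤₚ.+-*-commutativeRing

  ⊛≡∗ : ∀ n f g → (f ⊛ g) n ≡ (f ∗ g) n
  ⊛≡∗ zero    f g = ℤₚ.+-identityˡ _
  ⊛≡∗ (suc n) f g = ≡.trans (Σ<-suc (suc n) _) (≡.cong (λ s → f 0 ℤ.* g (suc n) ℤ.+ s) (⊛≡∗ n (f ∘ suc) g))
    where
    Σ<-suc : ∀ n f → Σ< (suc n) f ≡ f 0 ℤ.+ Σ< n (f ∘ suc)
    Σ<-suc zero    f = ℤₚ.+-comm (+ 0) (f 0)
    Σ<-suc (suc n) f = ≡.trans (≡.cong (ℤ._+ f (suc n)) (Σ<-suc n f)) (ℤₚ.+-assoc (f 0) _ _)

  mono-∗-< : ∀ k g n → n < k → (mono k ∗ g) n ≡ + 0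
  mono-∗-< (suc k) g zero    _         = ℤₚ.*-zeroˡ (g 0)
  mono-∗-< (suc k) g (suc n) (s≤s n<k) = ≡.trans (≡.cong (ℤ._+ (mono k ∗ g) n) (ℤₚ.*-zeroˡ (g (suc n))))
    (≡.trans (ℤₚ.+-identityˡ _) (mono-∗-< k g n n<k))

  mono-∗-+ : ∀ k g n → (mono k ∗ g) (k ℕ.+ n) ≡ g n
  mono-∗-+ zero    g n = ≡.trans (∗-congʳ n g (λ { zero → ≡.refl ; (suc _) → ≡.refl })) (∗-identityˡ n g)
  mono-∗-+ (suc k) g n = ≡.trans (≡.cong (ℤ._+ (mono k ∗ g) (k ℕ.+ n)) (ℤₚ.*-zeroˡ (g (suc (k ℕ.+ n)))))
    (≡.trans (ℤₚ.+-identityˡ _) (mono-∗-+ k g n))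

  mono-≢ : ∀ e n → n < e → mono e n ≡ + 0
  mono-≢ (suc e) zero    _         = ≡.refl
  mono-≢ (suc e) (suc n) (s≤s n<e) = mono-≢ e n n<e

  mono-shift : ∀ k l n → mono (k ℕ.+ l) (k ℕ.+ n) ≡ mono l n
  mono-shift zero    l n = ≡.refl
  mono-shift (suc k) l n = mono-shift k l n

  mono-+ : ∀ k l n → mono (k ℕ.+ l) n ≡ (mono k ∗ mono l) n
  mono-+ k l n with n ℕₚ.<? k
  ... | yes n<k = ≡.trans (mono-≢ (k ℕ.+ l) n (ℕₚ.≤-trans n<k (ℕₚ.m≤m+n k l))) (≡.sym (mono-∗-< k (mono l) n n<k))
  ... | no n≮k with ℕₚ.m≤n⇒∃[o]m+o≡n (ℕₚ.≮⇒≥ n≮k)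
  ...   | m , ≡.refl = ≡.trans (mono-shift k l m) (≡.sym (mono-∗-+ k (mono l) m))

  -- Below k+1 only 0 is a multiple of k+1; from there on, subtracting k+1 preserves divisibility.
  geom-eq : ∀ k n → geom (suc k) n ≡ one n ℤ.+ (mono (suc k) ∗ geom (suc k)) n
  geom-eq k n with n ℕₚ.<? suc k
  geom-eq k zero    | yes n<k = ≡.sym (≡.cong (λ x → + 1 ℤ.+ x) (mono-∗-< (suc k) (geom (suc k)) 0 n<k))
  geom-eq k (suc n) | yes n<k = ≡.trans
    (≡.cong (λ b → if b then + 1 else + 0) (dec-false (suc k ∣? suc n) (>⇒∤ n<k)))
    (≡.sym (≡.cong (λ x → + 0 ℤ.+ x) (mono-∗-< (suc k) (geom (suc k)) (suc n) n<k)))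
  geom-eq k n       | no n≮k with ℕₚ.m≤n⇒∃[o]m+o≡n (ℕₚ.≮⇒≥ n≮k)
  ... | m , ≡.refl = ≡.trans
    (≡.cong (λ b → if b then + 1 else + 0) (does-⇔ (mk⇔ (λ d → ∣m+n∣m⇒∣n d ∣-refl) (∣m∣n⇒∣m+n ∣-refl))
      (suc k ∣? suc k ℕ.+ m) (suc k ∣? m)))
    (≡.sym (≡.trans (ℤₚ.+-identityˡ _) (mono-∗-+ (suc k) (geom (suc k)) m)))

  monomialPowers : ∀ N K → N < K → QPowers (truncatedRing N) K
  monomialPowers N K N<K = record
    { q^_      = mono
    ; geo      = geom
    ; q^0      = λ { zero _ → ≡.refl ; (suc n) _ → ≡.refl }
    ; q^-+     = λ k l n _ → mono-+ k l n
    ; geo-eq   = λ k n _ → ≡.trans (geom-eq k n) (≡.cong (ℤ._+ (mono (suc k) ∗ geom (suc k)) n) (one≡δ n))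
    ; q^-large = λ e K≤e n n≤N → mono-≢ e n (ℕₚ.≤-trans (s≤s n≤N) (ℕₚ.≤-trans N<K K≤e))
    }
    where
    one≡δ : ∀ n → one n ≡ δ n
    one≡δ zero    = ≡.refl
    one≡δ (suc n) = ≡.refl

-- Partial sums and products modulo q^(N+1).

module Truncation (N K : ℕ) (N<K : N < K) where
  open PowerSeries ℤₚ.+-*-commutativeRing using (truncatedRing)
  open CommutativeRing (truncatedRing N)
  open Sums (truncatedRing N) using (∑; ∑-cong)
  open QSeries (truncatedRing N) K (ℕₚ.≤-trans (s≤s z≤n) N<K) (monomialPowers N K N<K)

  infixl 7 _⊛≈_

  _⊛≈_ : ∀ {f f′ g g′} → f ≈ f′ → g ≈ g′ → f ⊛ g ≈ f′ * g′
  _⊛≈_ {f} {f′} {g} {g′} p r n n≤N = ≡.trans (⊛≡∗ n f g) (*-cong {f} {f′} {g} {g′} p r n n≤N)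

  invPoch≈ip : ∀ a d m → invPoch a d m ≈ ip a d m
  invPoch≈ip a d zero    = λ { zero _ → ≡.refl ; (suc _) _ → ≡.refl }
  invPoch≈ip a d (suc m) = invPoch≈ip a d m ⊛≈ λ _ _ → ≡.refl

  Σ<-cong : ∀ n {f g} → (∀ k → f k ≡ g k) → Σ< n f ≡ Σ< n g
  Σ<-cong zero    p = ≡.refl
  Σ<-cong (suc n) p = ≡.cong₂ ℤ._+_ (Σ<-cong n p) (p n)

  ∑-coefficient : ∀ m f n → ∑ m f n ≡ Σ< m (λ k → f k n)
  ∑-coefficient zero    f n = ≡.refl
  ∑-coefficient (suc m) f n = ≡.cong (ℤ._+ f m n) (∑-coefficient m f n)

  term≈ : ∀ m n → term m n ≈ mono (expo m n) * ip 1 1 m * ip 4 4 (n / 2)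
  term≈ m n = (λ _ _ → ≡.refl) ⊛≈ invPoch≈ip 1 1 m ⊛≈ invPoch≈ip 4 4 (n / 2)

  lhsPartial≡ : lhsPartial K N ≡ doubleSum N
  lhsPartial≡ = ≡.trans
    (Σ<-cong K (λ m → ≡.trans (Σ<-cong K (λ n → term≈ m n N ℕₚ.≤-refl)) (≡.sym (∑-coefficient K _ N))))
    (≡.sym (∑-coefficient K _ N))

  triple≈ : ∀ a b c → invPoch a 8 K ⊛ invPoch b 8 K ⊛ invPoch c 8 K ≈ ip a 8 K * ip b 8 K * ip c 8 K
  triple≈ a b c = invPoch≈ip a 8 K ⊛≈ invPoch≈ip b 8 K ⊛≈ invPoch≈ip c 8 K

  lhsPartial≡rhsPartial : lhsPartial K N ≡ rhsPartial K N
  lhsPartial≡rhsPartial = begin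
    lhsPartial K N                         ≡⟨ lhsPartial≡ ⟩
    -- `doubleSum-ip` has the second product added on the left; it is subtracted only here, in the
    -- integers.
    doubleSum N                            ≡⟨ xyx⁻¹≈y B (doubleSum N) ⟨
    B ℤ.+ doubleSum N ℤ.- B                ≡⟨ ≡.cong (ℤ._- B) (ℤₚ.+-comm B (doubleSum N)) ⟩
    doubleSum N ℤ.+ B ℤ.- B                ≡⟨ ≡.cong (ℤ._- B) (doubleSum-ip N ℕₚ.≤-refl) ⟩
    (ip 1 8 K * ip 5 8 K * ip 6 8 K) N ℤ.- B
      ≡⟨ ≡.cong₂ ℤ._-_ (triple≈ 1 5 6 N ℕₚ.≤-refl) (triple≈ 2 3 7 N ℕₚ.≤-refl) ⟨
    rhsPartial K N                         ∎
    where
    open ≡.≡-Reasoning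
    open AbelianGroupProperties ℤₚ.+-0-abelianGroup using (xyx⁻¹≈y)
    B : ℤ
    B = (ip 2 8 K * ip 3 8 K * ip 7 8 K) N

theorem1p2 : (N : ℕ) → ∃[ M ] ((K : ℕ) → M ≤ K → lhsPartial K N ≡ rhsPartial K N)
-- Any K above N is enough: the terms and factors that the cutoff K drops affect only exponents
-- beyond N.
theorem1p2 N = suc N , λ K N<K → Truncation.lhsPartial≡rhsPartial N K N<K
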